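{- The advice complexity of the Online Interval Selection problem on a simple chain of $n$ intervals is at least $n/4$.
   Context: A simple chain of size $n$ is a set of $n$ unit-length intervals $I_1,\dots,I_n$ on the real line, numbered successively from left to right, whose overlaps represent a path graph on $n$ vertices: $I_i$ and $I_j$ ($i\neq j$) overlap if and only if $|i-j|=1$. Online Interval Selection (unweighted): a set of $n$ intervals arrives one by one, in any order chosen by an adversary. As each interval arrives, the algorithm must decide whether to accept or reject it, so that the selected intervals never overlap. In the revocable acceptances setting, the algorithm may also revoke previously selected intervals in order to accept new ones, maintaining a set of non-overlapping intervals at all times. The objective is to maximize the number of selected intervals. Advice setting: an all-powerful trustworthy oracle, which has full knowledge of the input in advance, populates an advice tape with bits according to a pre-agreed protocol. The online algorithm has the option to read the advice bits to achieve the best possible performance against an adversary. The advice complexity of an algorithm is the worst-case number of advice bits it reads on inputs of length $n$. The advice complexity of the problem is the smallest advice complexity of an online algorithm with advice that obtains an optimal solution (a maximum-size set of pairwise non-overlapping intervals) on every input.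
   Formalization: The bound n/4 is proved for all sufficiently large n, since it fails for some small n: a chain of 1, 2 or 4 intervals is solved optimally by a greedy algorithm with no advice. -}

module Defs where

open import Data.Bool using (Bool)
open import Data.Fin as Fin using (Fin; toℕ)
open import Data.Fin.Permutation using (Permutation′; _⟨$⟩ʳ_)
open import Data.Fin.Subset using (Subset; _∈_; _⊆_; ∣_∣)
open import Data.Integer using (+_)
open import Data.List using (List; []; _∷_; length)
open import Data.Nat as ℕ using (ℕ; suc; ∣_-_∣)
open import Data.Product using (Σ-syntax; _×_; _,_; proj₁; proj₂)
open import Data.Rational as ℚ using (ℚ; 1ℚ)
open import Data.Unit using (⊤)
open import Data.Vec as Vec using (Vec; []; _∷_; lookup)
open import Function.Bundles using (_⇔_)
open import Relation.Binary.PropositionalEquality using (_≡_; _≢_)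
open import Relation.Nullary using (¬_)

-- Intervals [start , finish) on the rational line.  Restricting the adversary
-- to rational endpoints can only strengthen a lower bound on advice.
record Interval : Set where
  constructor [_,_⟩
  field
    start finish : ℚ

open Interval public

UnitLength : Interval → Set
UnitLength I = finish I ≡ start I ℚ.+ 1ℚ

Overlap : Interval → Interval → Set
Overlap I J = start I ℚ.< finish J × start J ℚ.< finish I

record IsSimpleChain {n : ℕ} (I : Fin n → Interval) : Set where
  field
    unitLength  : ∀ i → UnitLength (I i)
    leftToRight : ∀ {i j} → i Fin.< j → start (I i) ℚ.< start (I j)
    path        : ∀ {i j} → i ≢ j → Overlap (I i) (I j) ⇔ (∣ toℕ i - toℕ j ∣ ≡ 1)

-- The intervals that have arrived so far, most recent first.  The history at
-- the end of the sequence is the whole input, and the tail of a history is the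
-- history one step earlier.
History : ℕ → Set
History = Vec Interval

IsChainInput : ∀ {n} → History n → Set
IsChainInput {n} h =
  Σ[ π ∈ Permutation′ n ] IsSimpleChain (λ i → lookup h (π ⟨$⟩ʳ i))

Independent : ∀ {t} → History t → Subset t → Set
Independent h S =
  ∀ {i j} → i ∈ S → j ∈ S → i ≢ j → ¬ Overlap (lookup h i) (lookup h j)

Optimal : ∀ {t} → History t → Subset t → Set
Optimal h S = Independent h S × (∀ T → Independent h T → ∣ T ∣ ℕ.≤ ∣ S ∣)

data Setting : Set where
  irrevocable revocable : Setting

-- `Vec.tail S′` is the part of the new selection S′ that concerns the earlier
-- intervals; the newest interval may be accepted or rejected in either setting.
Permitted : Setting → ∀ {t} → Subset t → Subset (suc t) → Set
Permitted revocable   S S′ = Vec.tail S′ ⊆ S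
Permitted irrevocable S S′ = Vec.tail S′ ≡ S

Tape : Set
Tape = ℕ → Bool

-- A computation that reads finitely many further advice bits, adaptively.
data Reading (A : Set) : Set where
  return : A → Reading A
  read   : (Bool → Reading A) → Reading A

-- The second component is the list of all bits read so far, most recent first.
consult : ∀ {A} → Tape → Reading A → List Bool → A × List Bool
consult φ (return a) bits = a , bits
consult φ (read k)   bits = consult φ (k b) (b ∷ bits)
  where b = φ (length bits)

-- The earlier selections are determined by the history and the bits read, so
-- these two are all an algorithm's next selection can depend on.
record AlgorithmWithAdvice (n : ℕ) : Set where
  field
    step   : ∀ {t} → History (suc t) → List Bool → Reading (Subset (suc t))
    oracle : History n → Tape

  run : Tape → ∀ {t} → History t → Subset t × List Bool
  run φ []      = [] , []
  run φ (I ∷ h) = consult φ (step (I ∷ h) bits) bits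
    where bits = proj₂ (run φ h)

  selection : Tape → ∀ {t} → History t → Subset t
  selection φ h = proj₁ (run φ h)

  bitsRead : Tape → ∀ {t} → History t → ℕ
  bitsRead φ h = length (proj₂ (run φ h))

  Legal : Setting → Tape → ∀ {t} → History t → Set
  Legal s φ []      = ⊤
  Legal s φ (I ∷ h) =
    Legal s φ h
    × Permitted s (selection φ h) (selection φ (I ∷ h))
    × Independent (I ∷ h) (selection φ (I ∷ h))

  OptimalOnChains : Setting → Set
  OptimalOnChains s = ∀ h → IsChainInput h →
    Legal s (oracle h) h × Optimal h (selection (oracle h) h)

  ReadsAtMost : ℕ → Set
  ReadsAtMost b = ∀ h → IsChainInput h → bitsRead (oracle h) h ℕ.≤ b

-- The algorithm is chosen after n, so it may know n.
AdviceSuffices : Setting → ℕ → ℕ → Set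
AdviceSuffices s n b =
  Σ[ A ∈ AlgorithmWithAdvice n ] (OptimalOnChains A s × ReadsAtMost A b)
  where open AlgorithmWithAdvice

-- The advice complexity on simple chains of n intervals is the least b with
-- `AdviceSuffices s n b`, so it is at least x iff every such b is.
AdviceComplexity≥ : Setting → ℕ → ℚ → Set
AdviceComplexity≥ s n x = ∀ b → AdviceSuffices s n b → x ℚ.≤ + b ℚ./ 1

{-# OPTIONS --safe #-}

-- The adversary first presents k disjoint pairs of overlapping intervals and then
-- one or two fillers before each pair (further fillers complete the chain on the
-- right).  An algorithm keeps at most one interval of each pair, and of the 2ᵏ
-- choices of filler counts d any fixed choice among the pairs suits only few: an
-- optimal selection consists of the odd intervals of a prefix of the chain and the
-- even intervals of the rest, so at each pair the parity of its position, compared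
-- with the choice made, agrees up to some pair and disagrees from there on, which
-- allows only k + 1 of the d.  Tapes of b bits yield 2ᵇ choices, so if
-- 2ᵇ · 2(k + 1) < 2ᵏ, then some d and its complement are both missed by all tapes.
-- One of the two uses at most 3k/2 fillers, which fit into a chain of 7k/2 intervals;
-- hence b is at least 2n/7 − O(log n), which exceeds n/4 for large n.
module Submission where

open import Data.Bool using (Bool; true; false; not; _xor_)
open import Data.Bool.Properties using (not-involutive)
open import Data.Fin as Fin using (Fin; zero; suc; toℕ; join; _↑ʳ_)
open import Data.Fin.Permutation using (Permutation; _⟨$⟩ʳ_; _⟨$⟩ˡ_; inverseʳ; inverseˡ; ↔⇒≡)
open import Data.Fin.Properties as Fin using (+↔⊎)
open import Data.Fin.Subset using (Subset; _∈_; _⊆_; ∣_∣)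
open import Data.Fin.Subset.Properties using (drop-∷-⊆)
import Data.Integer as ℤ
import Data.Integer.Properties as ℤ
open import Data.List using (_∷_; length)
open import Data.Maybe using (Maybe; just; nothing; maybe′)
open import Data.Nat as ℕ
  using (ℕ; zero; suc; _+_; _*_; _^_; _∸_; _%_; _≤_; _<_; z≤n; s≤s; s≤s⁻¹; s<s⁻¹; ∣_-_∣; _≤?_; _<?_)
open import Data.Nat.DivMod using (m≡m%n+[m/n]*n; m%n<n; m/n*n≤m; /-monoˡ-≤)
open import Data.Nat.Properties
open import Data.Nat.Solver using (module +-*-Solver)
open import Data.Product using (Σ-syntax; ∃-syntax; _×_; _,_; proj₁; proj₂)
open import Data.Rational as ℚ using (ℚ; 0ℚ; 1ℚ)
import Data.Rational.Properties as ℚ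
import Data.Rational.Unnormalised as ℚᵘ
import Data.Rational.Unnormalised.Properties as ℚᵘ
open import Data.Sum as Sum using (_⊎_; inj₁; inj₂; [_,_]′)
open import Data.Unit using (⊤; tt)
open import Data.Vec as Vec using (Vec; []; _∷_; _++_; lookup; map; splitAt; here; there)
open import Data.Vec.Properties using (lookup-++ˡ; lookup-++ʳ; lookup-map; []=⇒lookup; lookup⇒[]=)
open import Function.Base using (_∘_)
open import Function.Bundles using (_↔_; mk↔ₛ′; mk⇔; Inverse; Equivalence)
open import Function.Construct.Composition using (_↔-∘_)
open import Function.Construct.Symmetry using (↔-sym)
open import Relation.Binary.Definitions using (tri<; tri≈; tri>)
open import Relation.Binary.PropositionalEquality
  using (_≡_; _≢_; refl; sym; trans; cong; cong₂; subst; subst₂; module ≡-Reasoning)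
open import Relation.Nullary using (¬_; yes; no; contradiction)
open import Relation.Nullary.Decidable using (True; toWitness)
open import Defs
open +-*-Solver

-- Interleaving two histories

private
  variable
    A B : Set
    k m n p : ℕ

-- How a history xs ++ ys interleaves, from left to right on the line, with xs and ys
-- each kept in order.
data Weaving : ℕ → ℕ → ℕ → Set where
  done  : Weaving 0 0 0
  left  : Weaving m p n → Weaving (suc m) p (suc n)
  right : Weaving m p n → Weaving m (suc p) (suc n)

weave : Weaving m p n → Vec A m → Vec A p → Vec A n
weave done      []       []       = []
weave (left σ)  (x ∷ xs) ys       = x ∷ weave σ xs ys
weave (right σ) xs       (y ∷ ys) = y ∷ weave σ xs ys

weave-surjective : (σ : Weaving m p n) (zs : Vec A n) →
                   Σ[ xs ∈ Vec A m ] Σ[ ys ∈ Vec A p ] weave σ xs ys ≡ zs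
weave-surjective done      []       = [] , [] , refl
weave-surjective (left σ)  (z ∷ zs) with weave-surjective σ zs
... | xs , ys , eq = z ∷ xs , ys , cong (z ∷_) eq
weave-surjective (right σ) (z ∷ zs) with weave-surjective σ zs
... | xs , ys , eq = xs , z ∷ ys , cong (z ∷_) eq

map-weave : (f : A → B) (σ : Weaving m p n) (xs : Vec A m) (ys : Vec A p) →
            map f (weave σ xs ys) ≡ weave σ (map f xs) (map f ys)
map-weave f done      []       []       = refl
map-weave f (left σ)  (x ∷ xs) ys       = cong (f x ∷_) (map-weave f σ xs ys)
map-weave f (right σ) xs       (y ∷ ys) = cong (f y ∷_) (map-weave f σ xs ys)

∣++∣ : (X : Subset m) (Y : Subset p) → ∣ X ++ Y ∣ ≡ ∣ X ∣ + ∣ Y ∣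
∣++∣ []          Y = refl
∣++∣ (true  ∷ X) Y = cong suc (∣++∣ X Y)
∣++∣ (false ∷ X) Y = ∣++∣ X Y

∣weave∣ : (σ : Weaving m p n) (X : Subset m) (Y : Subset p) →
          ∣ weave σ X Y ∣ ≡ ∣ X ++ Y ∣
∣weave∣ σ X Y = trans (go σ X Y) (sym (∣++∣ X Y))
  where
  go : (σ : Weaving m p n) (X : Subset m) (Y : Subset p) → ∣ weave σ X Y ∣ ≡ ∣ X ∣ + ∣ Y ∣
  go done      []          []          = refl
  go (left σ)  (true  ∷ X) Y           = cong suc (go σ X Y)
  go (left σ)  (false ∷ X) Y           = go σ X Y
  go (right σ) X           (true  ∷ Y) = trans (cong suc (go σ X Y)) (sym (+-suc ∣ X ∣ ∣ Y ∣))
  go (right σ) X           (false ∷ Y) = go σ X Y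

unweave : Weaving m p n → Fin n ↔ (Fin m ⊎ Fin p)
unweave σ = mk↔ₛ′ (to σ) (from σ) (to∘from σ) (from∘to σ)
  where
  to : Weaving m p n → Fin n → Fin m ⊎ Fin p
  to (left σ)  zero    = inj₁ zero
  to (left σ)  (suc i) = Sum.map₁ suc (to σ i)
  to (right σ) zero    = inj₂ zero
  to (right σ) (suc i) = Sum.map₂ suc (to σ i)

  from : Weaving m p n → Fin m ⊎ Fin p → Fin n
  from (left σ)  (inj₁ zero)    = zero
  from (left σ)  (inj₁ (suc i)) = suc (from σ (inj₁ i))
  from (left σ)  (inj₂ j)       = suc (from σ (inj₂ j))
  from (right σ) (inj₁ i)       = suc (from σ (inj₁ i))
  from (right σ) (inj₂ zero)    = zero
  from (right σ) (inj₂ (suc j)) = suc (from σ (inj₂ j))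

  to∘from : (σ : Weaving m p n) → ∀ s → to σ (from σ s) ≡ s
  to∘from (left σ)  (inj₁ zero)    = refl
  to∘from (left σ)  (inj₁ (suc i)) = cong (Sum.map₁ suc) (to∘from σ (inj₁ i))
  to∘from (left σ)  (inj₂ j)       = cong (Sum.map₁ suc) (to∘from σ (inj₂ j))
  to∘from (right σ) (inj₁ i)       = cong (Sum.map₂ suc) (to∘from σ (inj₁ i))
  to∘from (right σ) (inj₂ zero)    = refl
  to∘from (right σ) (inj₂ (suc j)) = cong (Sum.map₂ suc) (to∘from σ (inj₂ j))

  from-left : (σ : Weaving m p n) → ∀ s → from (left σ) (Sum.map₁ suc s) ≡ suc (from σ s)
  from-left σ (inj₁ i) = refl
  from-left σ (inj₂ j) = refl

  from-right : (σ : Weaving m p n) → ∀ s → from (right σ) (Sum.map₂ suc s) ≡ suc (from σ s)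
  from-right σ (inj₁ i) = refl
  from-right σ (inj₂ j) = refl

  from∘to : (σ : Weaving m p n) → ∀ i → from σ (to σ i) ≡ i
  from∘to (left σ)  zero    = refl
  from∘to (left σ)  (suc i) = trans (from-left σ (to σ i)) (cong suc (from∘to σ i))
  from∘to (right σ) zero    = refl
  from∘to (right σ) (suc i) = trans (from-right σ (to σ i)) (cong suc (from∘to σ i))

-- Sends a position on the line to an index of the history `xs ++ ys`. Histories list the most
-- recent interval first, so all of `ys` arrives before `xs`.
arrival : Weaving m p n → Permutation n (m + p)
arrival σ = ↔-sym +↔⊎ ↔-∘ unweave σ

lookup-arrival : (σ : Weaving m p n) (xs : Vec A m) (ys : Vec A p) → ∀ i →
                 lookup (xs ++ ys) (arrival σ ⟨$⟩ʳ i) ≡ lookup (weave σ xs ys) i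
lookup-arrival σ xs ys i = trans (lookup-join xs ys (Inverse.to (unweave σ) i)) (go σ xs ys i)
  where
  choose : Vec A m → Vec A p → Fin m ⊎ Fin p → A
  choose xs ys = [ lookup xs , lookup ys ]′

  lookup-join : (xs : Vec A m) (ys : Vec A p) → ∀ s →
                lookup (xs ++ ys) (join m p s) ≡ choose xs ys s
  lookup-join xs ys (inj₁ i) = lookup-++ˡ xs ys i
  lookup-join xs ys (inj₂ j) = lookup-++ʳ xs ys j

  choose-left : (x : A) (xs : Vec A m) (ys : Vec A p) → ∀ s →
                choose (x ∷ xs) ys (Sum.map₁ suc s) ≡ choose xs ys s
  choose-left x xs ys (inj₁ i) = refl
  choose-left x xs ys (inj₂ j) = refl

  choose-right : (xs : Vec A m) (y : A) (ys : Vec A p) → ∀ s →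
                 choose xs (y ∷ ys) (Sum.map₂ suc s) ≡ choose xs ys s
  choose-right xs y ys (inj₁ i) = refl
  choose-right xs y ys (inj₂ j) = refl

  go : (σ : Weaving m p n) (xs : Vec A m) (ys : Vec A p) → ∀ i →
       choose xs ys (Inverse.to (unweave σ) i) ≡ lookup (weave σ xs ys) i
  go (left σ)  (x ∷ xs) ys       zero    = refl
  go (left σ)  (x ∷ xs) ys       (suc i) = trans (choose-left x xs ys (Inverse.to (unweave σ) i)) (go σ xs ys i)
  go (right σ) xs       (y ∷ ys) zero    = refl
  go (right σ) xs       (y ∷ ys) (suc i) = trans (choose-right xs y ys (Inverse.to (unweave σ) i)) (go σ xs ys i)

lookup-arrival⁻¹ : (σ : Weaving m p n) (xs : Vec A m) (ys : Vec A p) → ∀ j →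
                   lookup (weave σ xs ys) (arrival σ ⟨$⟩ˡ j) ≡ lookup (xs ++ ys) j
lookup-arrival⁻¹ σ xs ys j =
  trans (sym (lookup-arrival σ xs ys (arrival σ ⟨$⟩ˡ j)))
        (cong (lookup (xs ++ ys)) (inverseʳ (arrival σ)))

-- Independence speaks only of pairs of distinct selected indices, so it can be pulled back along an
-- injection that preserves intervals and membership.
independent-reindex : (h : History n) (g : History m) {S : Subset n} {S′ : Subset m} (f : Fin m → Fin n) →
                      (∀ {i j} → f i ≡ f j → i ≡ j) →
                      (∀ i → lookup h (f i) ≡ lookup g i) → (∀ i → lookup S (f i) ≡ lookup S′ i) →
                      Independent h S → Independent g S′
independent-reindex h g {S} f f-injective h≗g S≗S′ ind {i} {j} i∈S′ j∈S′ i≢j meets =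
  ind (lookup⇒[]= (f i) S (trans (S≗S′ i) ([]=⇒lookup i∈S′)))
      (lookup⇒[]= (f j) S (trans (S≗S′ j) ([]=⇒lookup j∈S′)))
      (i≢j ∘ f-injective)
      (subst₂ Overlap (sym (h≗g i)) (sym (h≗g j)) meets)

module _ (σ : Weaving m p n) (xs : History m) (ys : History p) {X : Subset m} {Y : Subset p} where

  independent-weave : Independent (xs ++ ys) (X ++ Y) → Independent (weave σ xs ys) (weave σ X Y)
  independent-weave = independent-reindex (xs ++ ys) (weave σ xs ys) (arrival σ ⟨$⟩ʳ_)
    (λ eq → trans (sym (inverseˡ (arrival σ))) (trans (cong (arrival σ ⟨$⟩ˡ_) eq) (inverseˡ (arrival σ))))
    (lookup-arrival σ xs ys) (lookup-arrival σ X Y)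

  independent-unweave : Independent (weave σ xs ys) (weave σ X Y) → Independent (xs ++ ys) (X ++ Y)
  independent-unweave = independent-reindex (weave σ xs ys) (xs ++ ys) (arrival σ ⟨$⟩ˡ_)
    (λ eq → trans (sym (inverseʳ (arrival σ))) (trans (cong (arrival σ ⟨$⟩ʳ_) eq) (inverseʳ (arrival σ))))
    (lookup-arrival⁻¹ σ xs ys) (lookup-arrival⁻¹ σ X Y)

optimal-weave : (σ : Weaving m p n) (xs : History m) (ys : History p) (X : Subset m) (Y : Subset p) →
                Optimal (xs ++ ys) (X ++ Y) → Optimal (weave σ xs ys) (weave σ X Y)
optimal-weave σ xs ys X Y (ind , maximum) = independent-weave σ xs ys ind , λ V indV → bound V indV
  where
  bound : ∀ V → Independent (weave σ xs ys) V → ∣ V ∣ ≤ ∣ weave σ X Y ∣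
  bound V indV with weave-surjective σ V
  ... | X′ , Y′ , refl = begin
    ∣ weave σ X′ Y′ ∣ ≡⟨ ∣weave∣ σ X′ Y′ ⟩
    ∣ X′ ++ Y′ ∣      ≤⟨ maximum (X′ ++ Y′) (independent-unweave σ xs ys indV) ⟩
    ∣ X ++ Y ∣        ≡⟨ ∣weave∣ σ X Y ⟨
    ∣ weave σ X Y ∣   ∎
    where open ≤-Reasoning

isChainInput-reindex : (π : Permutation n m) (h : History m) →
                       IsSimpleChain (λ i → lookup h (π ⟨$⟩ʳ i)) → IsChainInput h
isChainInput-reindex π h chain with refl ← ↔⇒≡ π = π , chain

-- Intervals with endpoints in ¼ℕ

¼ : ℚ
¼ = ℤ.+ 1 ℚ./ 4

-- Iterated addition, rather than a fraction, lets `quarters (4 + v)` unfold to four added quarters.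
quarters : ℕ → ℚ
quarters zero    = 0ℚ
quarters (suc v) = ¼ ℚ.+ quarters v

unitAt : ℕ → Interval
unitAt v = [ quarters v , quarters (4 + v) ⟩

unitAt-unitLength : ∀ v → UnitLength (unitAt v)
unitAt-unitLength v = begin
  ¼ ℚ.+ (¼ ℚ.+ (¼ ℚ.+ (¼ ℚ.+ q))) ≡⟨ ℚ.+-assoc ¼ ¼ (¼ ℚ.+ (¼ ℚ.+ q)) ⟨
  (¼ ℚ.+ ¼) ℚ.+ (¼ ℚ.+ (¼ ℚ.+ q)) ≡⟨ cong ((¼ ℚ.+ ¼) ℚ.+_) (ℚ.+-assoc ¼ ¼ q) ⟨
  (¼ ℚ.+ ¼) ℚ.+ ((¼ ℚ.+ ¼) ℚ.+ q) ≡⟨ ℚ.+-assoc (¼ ℚ.+ ¼) (¼ ℚ.+ ¼) q ⟨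
  -- The closed sum of four quarters computes to `1ℚ`.
  1ℚ ℚ.+ q                        ≡⟨ ℚ.+-comm 1ℚ q ⟩
  q ℚ.+ 1ℚ                        ∎
  where
  open ≡-Reasoning
  q = quarters v

quarters-suc : ∀ v → quarters v ℚ.< quarters (suc v)
quarters-suc v = subst (ℚ._< quarters (suc v)) (ℚ.+-identityˡ (quarters v))
  (ℚ.+-monoˡ-< (quarters v) {0ℚ} {¼} (toWitness {a? = 0ℚ ℚ.<? ¼} _))

quarters-mono-< : ∀ {u v} → u < v → quarters u ℚ.< quarters v
quarters-mono-< {u} {suc v} (s≤s u≤v) with m≤n⇒m<n∨m≡n u≤v
... | inj₁ u<v  = ℚ.<-trans (quarters-mono-< u<v) (quarters-suc v)
... | inj₂ refl = quarters-suc v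

quarters-cancel-< : ∀ {u v} → quarters u ℚ.< quarters v → u < v
quarters-cancel-< {u} {v} q<q with <-cmp u v
... | tri< u<v _ _  = u<v
... | tri≈ _ refl _ = contradiction q<q (ℚ.<-irrefl refl)
... | tri> _ _ v<u  = contradiction q<q (ℚ.<-asym (quarters-mono-< v<u))

unitAt-overlap : ∀ {u v} → u < 4 + v → v < 4 + u → Overlap (unitAt u) (unitAt v)
unitAt-overlap u< v< = quarters-mono-< u< , quarters-mono-< v<

-- The chain condition in local form: neighbouring starts lie less than a unit (four quarters)
-- apart, starts two positions apart at least a unit. As the starts increase, this also separates
-- all pairs further apart.
Spaced : Vec ℕ n → Set
Spaced []              = ⊤
Spaced (x ∷ [])        = ⊤
Spaced (x ∷ y ∷ [])    = x < y × y < 4 + x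
Spaced (x ∷ y ∷ z ∷ v) = x < y × y < 4 + x × 4 + x ≤ z × Spaced (y ∷ z ∷ v)

spaced-tail : ∀ x (v : Vec ℕ n) → Spaced (x ∷ v) → Spaced v
spaced-tail x []          _               = tt
spaced-tail x (y ∷ [])    _               = tt
spaced-tail x (y ∷ z ∷ v) (_ , _ , _ , s) = s

spaced-next : ∀ x y (v : Vec ℕ n) → Spaced (x ∷ y ∷ v) → x < y × y < 4 + x
spaced-next x y []      s                 = s
spaced-next x y (z ∷ v) (x<y , y<4+x , _) = x<y , y<4+x

spaced-mono : (v : Vec ℕ n) → Spaced v → ∀ {i j} → i Fin.< j → lookup v i < lookup v j
spaced-mono (x ∷ y ∷ v) s {zero}  {suc zero}    _   = proj₁ (spaced-next x y v s)
spaced-mono (x ∷ y ∷ v) s {zero}  {suc (suc j)} _   =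
  <-trans (proj₁ (spaced-next x y v s)) (spaced-mono (y ∷ v) (spaced-tail x (y ∷ v) s) (s≤s z≤n))
spaced-mono (x ∷ v)     s {suc i} {suc j}       i<j = spaced-mono v (spaced-tail x v s) (s<s⁻¹ i<j)

spaced-near : (v : Vec ℕ n) → Spaced v → ∀ i j → ∣ toℕ i - toℕ j ∣ ≡ 1 → lookup v i < 4 + lookup v j
spaced-near (x ∷ v)     s zero       zero       ()
spaced-near (x ∷ y ∷ v) s zero       (suc zero) _    = <-≤-trans (proj₁ (spaced-next x y v s)) (m≤n+m y 4)
spaced-near (x ∷ y ∷ v) s (suc zero) zero       _    = proj₂ (spaced-next x y v s)
spaced-near (x ∷ v)     s (suc i)    (suc j)    near = spaced-near v (spaced-tail x v s) i j near

spaced-far : (v : Vec ℕ n) → Spaced v → ∀ i j → i Fin.< j →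
             lookup v j < 4 + lookup v i → ∣ toℕ i - toℕ j ∣ ≡ 1
spaced-far (x ∷ v)         s zero    (suc zero)    _   _ = refl
spaced-far (x ∷ y ∷ z ∷ v) (_ , _ , 4+x≤z , s) zero (suc (suc zero)) _ near =
  contradiction near (≤⇒≯ 4+x≤z)
spaced-far (x ∷ y ∷ z ∷ v) (_ , _ , 4+x≤z , s) zero (suc (suc (suc j))) _ near =
  contradiction near (<-asym (≤-<-trans 4+x≤z (spaced-mono (y ∷ z ∷ v) s {suc zero} (s≤s (s≤s z≤n)))))
spaced-far (x ∷ v)         s (suc i) (suc j)       i<j near =
  spaced-far v (spaced-tail x v s) i j (s<s⁻¹ i<j) near

spaced⇒simpleChain : (v : Vec ℕ n) → Spaced v → (I : Fin n → Interval) →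
                     (∀ i → I i ≡ unitAt (lookup v i)) → IsSimpleChain I
spaced⇒simpleChain v s I I≗ = record
  { unitLength  = λ i → subst UnitLength (sym (I≗ i)) (unitAt-unitLength (lookup v i))
  ; leftToRight = λ {i} {j} i<j →
      subst₂ (λ J K → start J ℚ.< start K) (sym (I≗ i)) (sym (I≗ j)) (quarters-mono-< (spaced-mono v s i<j))
  ; path        = λ {i} {j} i≢j → mk⇔
      (λ meets → overlap⇒near i j i≢j (subst₂ Overlap (I≗ i) (I≗ j) meets))
      (λ near → subst₂ Overlap (sym (I≗ i)) (sym (I≗ j))
        (unitAt-overlap (spaced-near v s i j near)
                        (spaced-near v s j i (trans (∣-∣-comm (toℕ j) (toℕ i)) near))))
  }
  where
  overlap⇒near : ∀ i j → i ≢ j → Overlap (unitAt (lookup v i)) (unitAt (lookup v j)) → ∣ toℕ i - toℕ j ∣ ≡ 1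
  overlap⇒near i j i≢j (i<j+1 , j<i+1) with Fin.<-cmp i j
  ... | tri< i<j _ _ = spaced-far v s i j i<j (quarters-cancel-< j<i+1)
  ... | tri≈ _ i≡j _ = contradiction i≡j i≢j
  ... | tri> _ _ j<i = trans (∣-∣-comm (toℕ i) (toℕ j)) (spaced-far v s j i j<i (quarters-cancel-< i<j+1))

-- Optimal selections of a chain

NoAdjacent : Vec Bool n → Set
NoAdjacent []          = ⊤
NoAdjacent (x ∷ [])    = ⊤
NoAdjacent (x ∷ y ∷ v) = ¬ (x ≡ true × y ≡ true) × NoAdjacent (y ∷ v)

independent-tail : ∀ I (h : History n) s S → Independent (I ∷ h) (s ∷ S) → Independent h S
independent-tail I h s S ind i∈S j∈S i≢j = ind (there i∈S) (there j∈S) (i≢j ∘ Fin.suc-injective)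

independent⇒noAdjacent : (v : Vec ℕ n) (V : Subset n) → Spaced v →
                         Independent (map unitAt v) V → NoAdjacent V
independent⇒noAdjacent []          []          s ind = tt
independent⇒noAdjacent (x ∷ [])    (a ∷ [])    s ind = tt
independent⇒noAdjacent (x ∷ y ∷ v) (a ∷ b ∷ V) s ind =
  (λ { (refl , refl) → ind here (there here) (λ ())
         (unitAt-overlap (spaced-near (x ∷ y ∷ v) s zero (suc zero) refl)
                         (spaced-near (x ∷ y ∷ v) s (suc zero) zero refl)) }) ,
  independent⇒noAdjacent (y ∷ v) (b ∷ V) (spaced-tail x (y ∷ v) s)
    (independent-tail (unitAt x) (map unitAt (y ∷ v)) a (b ∷ V) ind)

alternating : Bool → ∀ n → Subset n
alternating b zero    = []
alternating b (suc n) = b ∷ alternating (not b) n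

∣alternating∣ : ∀ n → n ≤ 2 * ∣ alternating true n ∣
∣alternating∣ zero          = z≤n
∣alternating∣ (suc zero)    = s≤s z≤n
∣alternating∣ (suc (suc n)) =
  subst (2 + n ≤_) (sym (*-suc 2 ∣ alternating true n ∣)) (s≤s (s≤s (∣alternating∣ n)))

alternating-sparse : ∀ b {i j : Fin n} → i ∈ alternating b n → j ∈ alternating b n → ∣ toℕ i - toℕ j ∣ ≢ 1
alternating-sparse b     here               here               ()
alternating-sparse false (there i∈)         (there j∈)         near = alternating-sparse true i∈ j∈ near
alternating-sparse true  (there i∈)         (there j∈)         near = alternating-sparse false i∈ j∈ near
alternating-sparse .true here (there {i = zero} ())
alternating-sparse .true here (there {i = suc j} j∈) ()
alternating-sparse .true (there {i = zero} ()) here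
alternating-sparse .true (there {i = suc i} i∈) here ()

alternating-independent : (h : History n) → IsSimpleChain (lookup h) → Independent h (alternating true n)
alternating-independent h chain i∈ j∈ i≢j meets =
  alternating-sparse true i∈ j∈ (Equivalence.to (IsSimpleChain.path chain i≢j) meets)

-- The alternating selection is a competitor of at least half the size of the chain. This bound is
-- all that the scan below uses of maximality.
optimal⇒half : (h : History n) → IsSimpleChain (lookup h) → (V : Subset n) → Optimal h V → n ≤ 2 * ∣ V ∣
optimal⇒half {n} h chain V (_ , maximum) =
  ≤-trans (∣alternating∣ n) (*-monoʳ-≤ 2 (maximum _ (alternating-independent h chain)))

-- The hard instances

-- In quarters of a unit, the i-th pair starts at e + 8i + 4 and e + 8i + 6.  A single
-- filler before it starts at e + 8i + 1, two fillers start at e + 8i and e + 8i + 2.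
fillers : ∀ {k} → Vec Bool k → ℕ → ℕ
fillers []          r = r
fillers (false ∷ d) r = 1 + fillers d r
fillers (true  ∷ d) r = 2 + fillers d r

size : ∀ {k} → Vec Bool k → ℕ → ℕ
size []          r = r
size (false ∷ d) r = 3 + size d r
size (true  ∷ d) r = 4 + size d r

layout : ∀ {k} (d : Vec Bool k) r → Weaving (fillers d r) (k * 2) (size d r)
layout []          zero    = done
layout []          (suc r) = left (layout [] r)
layout (false ∷ d) r       = left (right (right (layout d r)))
layout (true  ∷ d) r       = left (left (right (right (layout d r))))

fillerStarts : ∀ {k} (d : Vec Bool k) r → ℕ → Vec ℕ (fillers d r)
fillerStarts []          zero    e = []
fillerStarts []          (suc r) e = e ∷ fillerStarts [] r (2 + e)
fillerStarts (false ∷ d) r       e = 1 + e ∷ fillerStarts d r (8 + e)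
fillerStarts (true  ∷ d) r       e = e ∷ 2 + e ∷ fillerStarts d r (8 + e)

pairStarts : ∀ k → ℕ → Vec ℕ (k * 2)
pairStarts zero    e = []
pairStarts (suc k) e = 4 + e ∷ 6 + e ∷ pairStarts k (8 + e)

chainStarts : ∀ {k} (d : Vec Bool k) r → ℕ → Vec ℕ (size d r)
chainStarts {k} d r e = weave (layout d r) (fillerStarts d r e) (pairStarts k e)

shift-≤ : ∀ {a b} e → {True (a ≤? b)} → a + e ≤ b + e
shift-≤ e {a≤b} = +-monoˡ-≤ e (toWitness a≤b)

chainStarts-spaced : ∀ {k} (d : Vec Bool k) r e → Spaced (chainStarts d r (4 + e))
chainStarts-spaced d r e =
  spaced-tail (2 + e) (chainStarts d r (4 + e)) (spaced-tail e (2 + e ∷ chainStarts d r (4 + e)) (go d r e))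
  where
  -- Spacing looks two positions back, so the induction carries the two preceding starts; at a block
  -- boundary they are the previous pair. The first block gets a phantom pair at `e` and `2 + e`,
  -- dropped afterwards; the offset 4 makes room for it.
  go : ∀ {k} (d : Vec Bool k) r e → Spaced (e ∷ 2 + e ∷ chainStarts d r (4 + e))
  go []          zero    e = shift-≤ {1} {2} e , shift-≤ {3} {4} e
  go []          (suc r) e = shift-≤ {1} {2} e , shift-≤ {3} {4} e , ≤-refl , go [] r (2 + e)
  go (false ∷ d) r       e =
    shift-≤ {1} {2} e , shift-≤ {3} {4} e , shift-≤ {4} {5} e ,
    shift-≤ {3} {5} e , shift-≤ {6} {6} e , shift-≤ {6} {8} e ,
    shift-≤ {6} {8} e , shift-≤ {9} {9} e , shift-≤ {9} {10} e , go d r (8 + e)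
  go (true ∷ d)  r       e =
    shift-≤ {1} {2} e , shift-≤ {3} {4} e , shift-≤ {4} {4} e ,
    shift-≤ {3} {4} e , shift-≤ {5} {6} e , shift-≤ {6} {6} e ,
    shift-≤ {5} {6} e , shift-≤ {7} {8} e , shift-≤ {8} {8} e ,
    shift-≤ {7} {8} e , shift-≤ {9} {10} e , shift-≤ {10} {10} e , go d r (8 + e)

-- Scanning an optimal selection

noAdjacent-tail : ∀ a (u : Vec Bool n) → NoAdjacent (a ∷ u) → NoAdjacent u
noAdjacent-tail a []      _       = tt
noAdjacent-tail a (b ∷ u) (_ , t) = t

noAdjacent-false : (u : Vec Bool n) → NoAdjacent u → NoAdjacent (false ∷ u)
noAdjacent-false []      _ = tt
noAdjacent-false (b ∷ u) t = (λ ()) , t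

-- A word that starts with `true` and alternates can exceed half its length, but not if the letter
-- before it is `true` already. The two bounds recurse into each other.
noAdjacent-bound : (u : Vec Bool n) →
                   (NoAdjacent u → 2 * ∣ u ∣ ≤ suc n) × (NoAdjacent (true ∷ u) → 2 * ∣ u ∣ ≤ n)
noAdjacent-bound []                  = (λ _ → z≤n) , (λ _ → z≤n)
noAdjacent-bound {suc n} (true ∷ u) =
  (λ t → subst (_≤ 2 + n) (sym (*-suc 2 ∣ u ∣)) (s≤s (s≤s (proj₂ (noAdjacent-bound u) t)))) ,
  (λ t → contradiction (refl , refl) (proj₁ t))
noAdjacent-bound (false ∷ u)         =
  (λ t → m≤n⇒m≤1+n (bound (noAdjacent-tail false u t))) ,
  (λ t → bound (noAdjacent-tail false u (proj₂ t)))
  where bound = proj₁ (noAdjacent-bound u)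

-- The letters still to be scanned are u, the last letter scanned is a, and s is one
-- more than twice the number of intervals selected so far minus the number scanned.
record Tight (a : Bool) (s : ℕ) (u : Vec Bool n) : Set where
  constructor tight
  field
    sparse : NoAdjacent (a ∷ u)
    large  : Vec.length u < s + 2 * ∣ u ∣

tight-true : ∀ {a s} {u : Vec Bool n} → Tight a s (true ∷ u) → a ≡ false × Tight true (suc s) u
tight-true {a = true}              (tight sparse large) = contradiction (refl , refl) (proj₁ sparse)
tight-true {a = false} {s} {u = u} (tight sparse large) =
  refl , tight (proj₂ sparse) (s≤s⁻¹ (≤-trans large (≤-reflexive eq)))
  where
  eq : s + 2 * suc ∣ u ∣ ≡ 2 + s + 2 * ∣ u ∣
  eq = trans (cong (s +_) (*-suc 2 ∣ u ∣))
             (trans (+-suc s (suc (2 * ∣ u ∣))) (cong suc (+-suc s (2 * ∣ u ∣))))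

tight-false : ∀ {a s} {u : Vec Bool n} → Tight a (suc s) (false ∷ u) → Tight false s u
tight-false (tight sparse large) = tight (proj₂ sparse) (s≤s⁻¹ large)

-- After a rejection the rest can make up a deficit of at most one, which is too little once `s` has
-- dropped to 0.
tight-zero : ∀ {a} {u : Vec Bool n} → ¬ Tight a 0 (false ∷ u)
tight-zero {u = u} (tight sparse large) =
  contradiction large (≤⇒≯ (proj₁ (noAdjacent-bound u) (noAdjacent-tail false u (proj₂ sparse))))

-- Until the skip an optimal selection alternates starting with the leftmost interval,
-- after it with the opposite parity.
data Phase : Set where
  early late : Phase

-- The Boolean after the phase is the parity of the number of letters scanned.
data Scan : Phase → Bool → Bool → ℕ → Set where
  earlyOut : Scan early false false 1
  earlyIn  : Scan early true  true  2
  lateOut  : ∀ {φ} → Scan φ true  false 0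
  lateIn   : ∀ {φ} → Scan φ false true  1

Scanned : Phase → Bool → Vec Bool n → Set
Scanned φ x u = ∃[ a ] ∃[ s ] Scan φ x a s × Tight a s u

scanned-step : ∀ {φ x g} {u : Vec Bool n} → Scanned φ x (g ∷ u) → Scanned φ (not x) u
scanned-step {g = false} (_ , _ , earlyOut , t) = _ , _ , lateOut , tight-false t
scanned-step {g = false} (_ , _ , earlyIn  , t) = _ , _ , earlyOut , tight-false t
scanned-step {g = false} (_ , _ , lateOut  , t) = contradiction t tight-zero
scanned-step {g = false} (_ , _ , lateIn   , t) = _ , _ , lateOut , tight-false t
scanned-step {g = true}  (_ , _ , earlyOut , t) = _ , _ , earlyIn , proj₂ (tight-true t)
scanned-step {g = true}  (_ , _ , earlyIn  , t) with () ← proj₁ (tight-true t)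
scanned-step {g = true}  (_ , _ , lateOut  , t) = _ , _ , lateIn , proj₂ (tight-true t)
scanned-step {g = true}  (_ , _ , lateIn   , t) with () ← proj₁ (tight-true t)

-- The Boolean says whether the interval kept in a pair has the parity selected before the skip. A
-- first disagreement forces the skip; an agreement after that is fatal.
advance : Phase → Bool → Maybe Phase
advance early true  = just early
advance early false = just late
advance late  true  = nothing
advance late  false = just late

-- One rejection uses up the slack, so a second one in a row is excluded by `tight-zero`.
tight-skip : ∀ {a r} {u : Vec Bool n} → Tight a 1 (false ∷ r ∷ u) → r ≡ true × Tight true 1 u
tight-skip {r = false} t = contradiction (tight-false t) tight-zero
tight-skip {r = true}  t = refl , proj₂ (tight-true (tight-false t))

scanned-pair : ∀ φ y {l r a b} {u : Vec Bool n} → Scanned φ y (l ∷ r ∷ u) →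
               (l ≡ true → a ≡ true) → (r ≡ true → b ≡ true) → ¬ (a ≡ true × b ≡ true) →
               ∃[ ψ ] advance φ (a xor y) ≡ just ψ × Scanned ψ y u
scanned-pair early true  {a = false} sc _ _ _ = early , refl , scanned-step (scanned-step sc)
scanned-pair early false {a = true}  sc _ _ _ = early , refl , scanned-step (scanned-step sc)
scanned-pair early false {true}  {a = false} _ l⇒a _ _ with () ← l⇒a refl
scanned-pair early false {false} {a = false} (_ , _ , earlyOut , t) _ _ _ =
  late , refl , _ , _ , lateIn , proj₂ (tight-skip t)
scanned-pair early false {false} {a = false} (_ , _ , lateIn , t) _ _ _ =
  late , refl , _ , _ , lateIn , proj₂ (tight-skip t)
scanned-pair φ true {r = true} {a = true} _ _ r⇒b free = contradiction (refl , r⇒b refl) free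
scanned-pair early true {true}  {false} {true} (_ , _ , earlyIn , t) _ _ _ with () ← proj₁ (tight-true t)
scanned-pair early true {false} {false} {true} (_ , _ , earlyIn , t) _ _ _ =
  late , refl , _ , _ , lateOut , tight-false (tight-false t)
scanned-pair φ true {false} (_ , _ , lateOut , t) _ _ _ = contradiction t tight-zero
scanned-pair early true {true} {false} {true} (_ , _ , lateOut , t) _ _ _ =
  late , refl , _ , _ , lateOut , tight-false (proj₂ (tight-true t))
scanned-pair late true {true} {false} {true} (_ , _ , lateOut , t) _ _ _ =
  late , refl , _ , _ , lateOut , tight-false (proj₂ (tight-true t))
scanned-pair late true {true} {a = false} _ l⇒a _ _ with () ← l⇒a refl
scanned-pair late false {true} (_ , _ , lateIn , t) _ _ _ with () ← proj₁ (tight-true t)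
scanned-pair late false {false} {a = a} (_ , _ , lateIn , t) _ r⇒b free with tight-skip t | a
... | refl , t′ | true  = contradiction (refl , r⇒b refl) free
... | refl , t′ | false = late , refl , _ , _ , lateIn , t′

-- Always 0 or 1, and 0 only if keeping, in each pair, at most the left interval
-- (c true) or at most the right one (c false) rules out an optimal selection.
hits : Phase → Bool → Vec Bool k → Vec Bool k → ℕ
hits φ x []       []       = 1
hits φ x (c ∷ cs) (d ∷ ds) = maybe′ (λ ψ → hits ψ y cs ds) 0 (advance φ (c xor y))
  -- A single filler (`false`) flips the parity, two fillers preserve it, and so does the pair
  -- itself.
  where y = not d xor x

lefts : ∀ k → Vec Bool (k * 2) → Vec Bool k
lefts zero    []          = []
lefts (suc k) (a ∷ b ∷ S) = a ∷ lefts k S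

PairFree : ∀ k → Vec Bool (k * 2) → Set
PairFree zero    []          = ⊤
PairFree (suc k) (a ∷ b ∷ S) = ¬ (a ≡ true × b ≡ true) × PairFree k S

⊆-head : ∀ {a b} {S T : Subset n} → (a ∷ S) ⊆ (b ∷ T) → a ≡ true → b ≡ true
⊆-head S⊆T refl with here ← S⊆T here = refl

-- `S` is the selection when the pairs have arrived and `Y` what finally remains of it. By
-- `scanned-pair`, `advance` never returns `nothing` along the scan.
scanned⇒hits : ∀ (d : Vec Bool k) r φ x X Y (S : Vec Bool (k * 2)) → Scanned φ x (weave (layout d r) X Y) →
               PairFree k S → Y ⊆ S → 1 ≤ hits φ x (lefts k S) d
scanned⇒hits []          r φ x X       Y           []          sc _            Y⊆S = ≤-refl
scanned⇒hits (false ∷ d) r φ x (g ∷ X) (l ∷ q ∷ Y) (a ∷ b ∷ S) sc (free , frees) Y⊆S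
  with scanned-pair φ (not x) (scanned-step sc) (⊆-head Y⊆S) (⊆-head (drop-∷-⊆ Y⊆S)) free
... | ψ , eq , sc′ rewrite eq = scanned⇒hits d r ψ (not x) X Y S sc′ frees (drop-∷-⊆ (drop-∷-⊆ Y⊆S))
scanned⇒hits (true ∷ d) r φ x (g ∷ g′ ∷ X) (l ∷ q ∷ Y) (a ∷ b ∷ S) sc (free , frees) Y⊆S
  with scanned-pair φ x (subst (λ z → Scanned φ z (l ∷ q ∷ weave (layout d r) X Y)) (not-involutive x)
                           (scanned-step (scanned-step sc)))
         (⊆-head Y⊆S) (⊆-head (drop-∷-⊆ Y⊆S)) free
... | ψ , eq , sc′ rewrite eq = scanned⇒hits d r ψ x X Y S sc′ frees (drop-∷-⊆ (drop-∷-⊆ Y⊆S))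

-- Sums over the cube

total : ∀ k → (Vec Bool k → ℕ) → ℕ
total zero    f = f []
total (suc k) f = total k (f ∘ (false ∷_)) + total k (f ∘ (true ∷_))

total-cong : ∀ k {f g : Vec Bool k → ℕ} → (∀ v → f v ≡ g v) → total k f ≡ total k g
total-cong zero    f≗g = f≗g []
total-cong (suc k) f≗g = cong₂ _+_ (total-cong k (f≗g ∘ (false ∷_))) (total-cong k (f≗g ∘ (true ∷_)))

total-const : ∀ k c → total k (λ _ → c) ≡ 2 ^ k * c
total-const zero    c = sym (+-identityʳ c)
total-const (suc k) c = begin
  total k (λ _ → c) + total k (λ _ → c) ≡⟨ cong₂ _+_ (total-const k c) (total-const k c) ⟩
  2 ^ k * c + 2 ^ k * c                 ≡⟨ *-distribʳ-+ c (2 ^ k) (2 ^ k) ⟨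
  (2 ^ k + 2 ^ k) * c                   ≡⟨ cong (λ z → (2 ^ k + z) * c) (+-identityʳ (2 ^ k)) ⟨
  2 ^ suc k * c                         ∎
  where open ≡-Reasoning

total-+ : ∀ k (f g : Vec Bool k → ℕ) → total k (λ v → f v + g v) ≡ total k f + total k g
total-+ zero    f g = refl
total-+ (suc k) f g = trans
  (cong₂ _+_ (total-+ k (f ∘ (false ∷_)) (g ∘ (false ∷_))) (total-+ k (f ∘ (true ∷_)) (g ∘ (true ∷_))))
  (solve 4 (λ a b c d → (a :+ b) :+ (c :+ d) := (a :+ c) :+ (b :+ d)) refl
    (total k (f ∘ (false ∷_))) (total k (g ∘ (false ∷_))) (total k (f ∘ (true ∷_))) (total k (g ∘ (true ∷_))))

total-swap : ∀ k m (f : Vec Bool k → Vec Bool m → ℕ) →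
             total k (λ v → total m (f v)) ≡ total m (λ w → total k (λ v → f v w))
total-swap zero    m f = refl
total-swap (suc k) m f = trans
  (cong₂ _+_ (total-swap k m (f ∘ (false ∷_))) (total-swap k m (f ∘ (true ∷_))))
  (sym (total-+ m (λ w → total k (λ v → f (false ∷ v) w)) (λ w → total k (λ v → f (true ∷ v) w))))

total-not : ∀ k (f : Vec Bool k → ℕ) → total k (f ∘ map not) ≡ total k f
total-not zero    f = refl
total-not (suc k) f = trans
  (cong₂ _+_ (total-not k (f ∘ (true ∷_))) (total-not k (f ∘ (false ∷_))))
  (+-comm (total k (f ∘ (true ∷_))) (total k (f ∘ (false ∷_))))

term≤total : ∀ k (f : Vec Bool k → ℕ) v → f v ≤ total k f
term≤total zero    f []          = ≤-refl
term≤total (suc k) f (false ∷ v) = ≤-trans (term≤total k (f ∘ (false ∷_)) v) (m≤m+n _ _)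
term≤total (suc k) f (true ∷ v)  = ≤-trans (term≤total k (f ∘ (true ∷_)) v) (m≤n+m _ _)

-- Pigeonhole by bisection: if the first half of the cube has too large a total, the second half
-- must have a small one.
total<⇒zero : ∀ k (f : Vec Bool k → ℕ) → total k f < 2 ^ k → ∃[ v ] f v ≡ 0
total<⇒zero zero    f f<1 = [] , n<1⇒n≡0 f<1
total<⇒zero (suc k) f f< with <-≤-connex (total k (f ∘ (false ∷_))) (2 ^ k)
... | inj₁ small with total<⇒zero k (f ∘ (false ∷_)) small
...   | v , eq = false ∷ v , eq
total<⇒zero (suc k) f f< | inj₂ large with total<⇒zero k (f ∘ (true ∷_)) small
  where
  small : total k (f ∘ (true ∷_)) < 2 ^ k
  small = +-cancelˡ-< (2 ^ k) _ _ (≤-<-trans (+-monoˡ-≤ _ large)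
            (subst (total (suc k) f <_) (cong (2 ^ k +_) (+-identityʳ (2 ^ k))) f<))
... | v , eq = true ∷ v , eq

-- Counting the instances that suit a fixed choice

capacity : Phase → ℕ → ℕ
capacity early k = suc k
capacity late  k = 1

-- At each pair exactly one filler count makes the choice agree with the early pattern. A hit is
-- thus determined by the place where agreement ends, for which there are `suc k` possibilities; in
-- phase `late` the continuation is unique.
total-hits : ∀ φ x (cs : Vec Bool k) → total k (hits φ x cs) ≡ capacity φ k
total-hits early x [] = refl
total-hits late  x [] = refl
total-hits {suc k} early true  (true  ∷ cs)
  rewrite total-hits early false cs | total-hits late true cs = cong suc (+-comm k 1)
total-hits {suc k} early true  (false ∷ cs)
  rewrite total-hits late false cs | total-hits early true cs = refl
total-hits {suc k} early false (true  ∷ cs)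
  rewrite total-hits late true cs | total-hits early false cs = refl
total-hits {suc k} early false (false ∷ cs)
  rewrite total-hits early true cs | total-hits late false cs = cong suc (+-comm k 1)
total-hits {suc k} late  true  (true  ∷ cs)
  rewrite total-const k 0 | *-zeroʳ (2 ^ k) = total-hits late true cs
total-hits {suc k} late  true  (false ∷ cs)
  rewrite total-const k 0 | *-zeroʳ (2 ^ k) | total-hits late false cs = refl
total-hits {suc k} late  false (true  ∷ cs)
  rewrite total-const k 0 | *-zeroʳ (2 ^ k) | total-hits late true cs = refl
total-hits {suc k} late  false (false ∷ cs)
  rewrite total-const k 0 | *-zeroʳ (2 ^ k) = total-hits late false cs

fillers-+ : (d : Vec Bool k) → ∀ r → fillers d r ≡ fillers d 0 + r
fillers-+ []          r = refl
fillers-+ (false ∷ d) r = cong suc (fillers-+ d r)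
fillers-+ (true  ∷ d) r = cong (2 +_) (fillers-+ d r)

-- At each pair one of `d` and its complement uses one filler and the other uses two.
fillers-not : (d : Vec Bool k) → fillers d 0 + fillers (map not d) 0 ≡ 3 * k
fillers-not []                  = refl
fillers-not {suc k} (false ∷ d) = begin
  1 + (fillers d 0 + (2 + fillers (map not d) 0)) ≡⟨ cong suc (trans (+-suc _ _) (cong suc (+-suc _ _))) ⟩
  3 + (fillers d 0 + fillers (map not d) 0)       ≡⟨ cong (3 +_) (fillers-not d) ⟩
  3 + 3 * k                                       ≡⟨ *-suc 3 k ⟨
  3 * suc k                                       ∎
  where open ≡-Reasoning
fillers-not {suc k} (true ∷ d)  = begin
  2 + (fillers d 0 + (1 + fillers (map not d) 0)) ≡⟨ cong (2 +_) (+-suc _ _) ⟩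
  3 + (fillers d 0 + fillers (map not d) 0)       ≡⟨ cong (3 +_) (fillers-not d) ⟩
  3 + 3 * k                                       ≡⟨ *-suc 3 k ⟨
  3 * suc k                                       ∎
  where open ≡-Reasoning

-- Double counting: each of the `2 ^ b` strings contributes `suc k` hits by `d` and, since
-- complementation permutes the cube, as many by `map not d`.
unhit-both : ∀ {b} (C : Vec Bool b → Vec Bool k) → 2 ^ b * (2 * suc k) < 2 ^ k →
             ∃[ d ] (∀ w → hits early false (C w) d + hits early false (C w) (map not d) ≡ 0)
unhit-both {k} {b} C few with total<⇒zero k (λ d → total b (λ w → both w d))
                                    (subst (_< 2 ^ k) (sym sum) few)
  where
  both : Vec Bool b → Vec Bool k → ℕ
  both w d = hits early false (C w) d + hits early false (C w) (map not d)

  sum-both : ∀ w → total k (both w) ≡ 2 * suc k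
  sum-both w = trans (total-+ k (hits early false (C w)) (hits early false (C w) ∘ map not))
    (cong₂ _+_ (total-hits early false (C w))
      (trans (total-not k (hits early false (C w)))
        (trans (total-hits early false (C w)) (sym (+-identityʳ (suc k))))))

  sum : total k (λ d → total b (λ w → both w d)) ≡ 2 ^ b * (2 * suc k)
  sum = trans (total-swap k b (λ d w → both w d))
          (trans (total-cong b sum-both) (total-const b (2 * suc k)))
... | d , eq = d , λ w → n≤0⇒n≡0 (subst (_ ≤_) eq (term≤total b _ w))

unhit : ∀ {b} (C : Vec Bool b → Vec Bool k) → 2 ^ b * (2 * suc k) < 2 ^ k →
        ∃[ d ] 2 * fillers d 0 ≤ 3 * k × (∀ w → hits early false (C w) d ≡ 0)
unhit {k} C few with unhit-both C few
... | d , none with ≤-total (fillers d 0) (fillers (map not d) 0)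
...   | inj₁ light = d , double light , λ w → m+n≡0⇒m≡0 _ (none w)
  where
  double : fillers d 0 ≤ fillers (map not d) 0 → 2 * fillers d 0 ≤ 3 * k
  double light = begin
    2 * fillers d 0                       ≡⟨ cong (fillers d 0 +_) (+-identityʳ (fillers d 0)) ⟩
    fillers d 0 + fillers d 0             ≤⟨ +-monoʳ-≤ (fillers d 0) light ⟩
    fillers d 0 + fillers (map not d) 0   ≡⟨ fillers-not d ⟩
    3 * k                                 ∎
    where open ≤-Reasoning
...   | inj₂ light = map not d , double light , λ w → m+n≡0⇒n≡0 _ (none w)
  where
  double : fillers (map not d) 0 ≤ fillers d 0 → 2 * fillers (map not d) 0 ≤ 3 * k
  double light = begin
    2 * fillers (map not d) 0
      ≡⟨ cong (fillers (map not d) 0 +_) (+-identityʳ (fillers (map not d) 0)) ⟩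
    fillers (map not d) 0 + fillers (map not d) 0   ≤⟨ +-monoˡ-≤ (fillers (map not d) 0) light ⟩
    fillers d 0 + fillers (map not d) 0             ≡⟨ fillers-not d ⟩
    3 * k                                           ∎
    where open ≤-Reasoning

-- Algorithms with advice

consult-length : ∀ (φ : Tape) (c : Reading A) bits → length bits ≤ length (proj₂ (consult φ c bits))
consult-length φ (return a) bits = ≤-refl
consult-length φ (read c)   bits = <⇒≤ (consult-length φ (c _) (_ ∷ bits))

-- A bit is read at index `length bits`, and this list never shrinks. If it ends with at most `b`
-- entries, all indices read lie below `b`, where the tapes agree.
consult-cong : ∀ {b} {φ ψ : Tape} → (∀ i → i < b → φ i ≡ ψ i) → (c : Reading A) → ∀ bits →
               length (proj₂ (consult φ c bits)) ≤ b → consult φ c bits ≡ consult ψ c bits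
consult-cong φ≗ψ (return a) bits _ = refl
consult-cong {φ = φ} {ψ} φ≗ψ (read c) bits short
  rewrite sym (φ≗ψ (length bits)
            (≤-trans (consult-length φ (c (φ (length bits))) (φ (length bits) ∷ bits)) short)) =
  consult-cong φ≗ψ (c (φ (length bits))) (φ (length bits) ∷ bits) short

-- The value `false` beyond the string is an arbitrary default; tapes are compared only below `b`.
pad : ∀ {b} → Vec Bool b → Tape
pad []      _       = false
pad (x ∷ w) zero    = x
pad (x ∷ w) (suc i) = pad w i

prefix : ∀ b → Tape → Vec Bool b
prefix zero    φ = []
prefix (suc b) φ = φ 0 ∷ prefix b (φ ∘ suc)

pad-prefix : ∀ b φ i → i < b → φ i ≡ pad (prefix b φ) i
pad-prefix (suc b) φ zero    _         = refl
pad-prefix (suc b) φ (suc i) (s≤s i<b) = pad-prefix b (φ ∘ suc) i i<b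

-- This is where the two settings merge: the lower bound uses only that an interval once dropped
-- never returns.
permitted⇒⊆ : ∀ s {S : Subset n} {S′} → Permitted s S S′ → Vec.tail S′ ⊆ S
permitted⇒⊆ irrevocable refl = λ i∈ → i∈
permitted⇒⊆ revocable   S⊆   = S⊆

module _ (alg : AlgorithmWithAdvice n) where
  open AlgorithmWithAdvice alg

  bitsRead-++ : ∀ φ (xs : History m) (ys : History p) → bitsRead φ ys ≤ bitsRead φ (xs ++ ys)
  bitsRead-++ φ []       ys = ≤-refl
  bitsRead-++ φ (x ∷ xs) ys = ≤-trans (bitsRead-++ φ xs ys) (consult-length φ (step (x ∷ xs ++ ys) _) _)

  run-cong : ∀ {b φ ψ} → (∀ i → i < b → φ i ≡ ψ i) → (h : History m) → bitsRead φ h ≤ b → run φ h ≡ run ψ h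
  run-cong φ≗ψ []      _     = refl
  run-cong {φ = φ} φ≗ψ (x ∷ h) short
    rewrite sym (run-cong φ≗ψ h (≤-trans (consult-length φ (step (x ∷ h) _) _) short)) =
    consult-cong φ≗ψ (step (x ∷ h) _) _ short

  legal-++ : ∀ s φ (xs : History m) (ys : History p) → Legal s φ (xs ++ ys) → Legal s φ ys
  legal-++ s φ []       ys legal       = legal
  legal-++ s φ (x ∷ xs) ys (legal , _) = legal-++ s φ xs ys legal

  legal⇒shrinks : ∀ s φ (xs : History m) (ys : History p) → Legal s φ (xs ++ ys) →
                  ∀ {j} → m ↑ʳ j ∈ selection φ (xs ++ ys) → j ∈ selection φ ys
  legal⇒shrinks s φ []       ys legal                   j∈ = j∈
  legal⇒shrinks s φ (x ∷ xs) ys (legal , permitted , _) j∈ =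
    legal⇒shrinks s φ xs ys legal (permitted⇒⊆ s permitted (∈-tail j∈))
    where
    ∈-tail : ∀ {n} {S : Subset (suc n)} {i} → suc i ∈ S → i ∈ Vec.tail S
    ∈-tail (there i∈) = i∈

  legal⇒independent : ∀ s φ (h : History m) → Legal s φ h → Independent h (selection φ h)
  legal⇒independent s φ []      _             {()}
  legal⇒independent s φ (x ∷ h) (_ , _ , ind) = ind

-- The adversary against a single algorithm

independent⇒pairFree : ∀ k e S → Independent (map unitAt (pairStarts k e)) S → PairFree k S
independent⇒pairFree zero    e []          _   = tt
independent⇒pairFree (suc k) e (a ∷ b ∷ S) ind =
  (λ { (refl , refl) → ind here (there here) (λ ())
         (unitAt-overlap (shift-≤ {5} {10} e) (shift-≤ {7} {8} e)) }) ,
  independent⇒pairFree k (8 + e) S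
    (independent-tail (unitAt (6 + e)) _ b S (independent-tail (unitAt (4 + e)) _ a (b ∷ S) ind))

-- Independent of `d` and `r`, so that every hard instance with `k` pairs begins with the same
-- arrivals.
pairs : ∀ k → History (k * 2)
pairs k = map unitAt (pairStarts k 4)

module _ (d : Vec Bool k) (r : ℕ) where

  private
    xs = map unitAt (fillerStarts d r 4)

  hard : History (fillers d r + k * 2)
  hard = xs ++ pairs k

  hard-weave : weave (layout d r) xs (pairs k) ≡ map unitAt (chainStarts d r 4)
  hard-weave = sym (map-weave unitAt (layout d r) (fillerStarts d r 4) (pairStarts k 4))

  lookup-hard : ∀ i → lookup hard (arrival (layout d r) ⟨$⟩ʳ i) ≡ unitAt (lookup (chainStarts d r 4) i)
  lookup-hard i = trans (lookup-arrival (layout d r) xs (pairs k) i)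
    (trans (cong (λ h → lookup h i) hard-weave) (lookup-map i unitAt (chainStarts d r 4)))

  hard-isChainInput : IsChainInput hard
  hard-isChainInput = isChainInput-reindex (arrival (layout d r)) hard
    (spaced⇒simpleChain (chainStarts d r 4) (chainStarts-spaced d r 0) _ lookup-hard)

  optimal⇒scanned : ∀ X Y → Optimal hard (X ++ Y) → Scanned early false (weave (layout d r) X Y)
  -- Before the scan a virtual rejected letter stands in front and `s` is 1, which turns `half` into
  -- the strict bound of `Tight`.
  optimal⇒scanned X Y optimal = _ , _ , earlyOut , tight (noAdjacent-false V noAdjacent) (s≤s half)
    where
    V = weave (layout d r) X Y

    optimal′ : Optimal (map unitAt (chainStarts d r 4)) V
    optimal′ = subst (λ h → Optimal h V) hard-weave (optimal-weave (layout d r) xs (pairs k) X Y optimal)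

    noAdjacent : NoAdjacent V
    noAdjacent = independent⇒noAdjacent (chainStarts d r 4) V (chainStarts-spaced d r 0) (proj₁ optimal′)

    half : size d r ≤ 2 * ∣ V ∣
    half = optimal⇒half (map unitAt (chainStarts d r 4))
      (spaced⇒simpleChain (chainStarts d r 4) (chainStarts-spaced d r 0) _
        (λ i → lookup-map i unitAt (chainStarts d r 4)))
      V optimal′

module _ (alg : AlgorithmWithAdvice n) where
  open AlgorithmWithAdvice alg

  firstSelection : ∀ k {b} → Vec Bool b → Vec Bool k
  firstSelection k w = lefts k (selection (pad w) (pairs k))

  -- The oracle knows `d`, but at most `b` bits of its tape have been read when the pairs are in
  -- place. The choice made there is therefore that of the padded `b`-bit prefix.
  optimal⇒hits : ∀ s {b} (d : Vec Bool k) r → fillers d r + k * 2 ≡ n →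
                 OptimalOnChains s → ReadsAtMost b →
                 Σ[ w ∈ Vec Bool b ] 1 ≤ hits early false (firstSelection k w) d
  optimal⇒hits {k} s {b} d r refl optimalOn readsAtMost =
    prefix b φ ,
    subst (λ ρ → 1 ≤ hits early false (lefts k (proj₁ ρ)) d) same
      (go _ optimal (legal⇒shrinks alg s φ _ (pairs k) legal))
    where
    φ = oracle (hard d r)
    S = selection φ (pairs k)
    legal = proj₁ (optimalOn (hard d r) (hard-isChainInput d r))
    optimal = proj₂ (optimalOn (hard d r) (hard-isChainInput d r))

    same : run φ (pairs k) ≡ run (pad (prefix b φ)) (pairs k)
    same = run-cong alg (pad-prefix b φ) (pairs k)
      (≤-trans (bitsRead-++ alg φ (map unitAt (fillerStarts d r 4)) (pairs k))
               (readsAtMost (hard d r) (hard-isChainInput d r)))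

    pairFree : PairFree k S
    pairFree = independent⇒pairFree k 4 S
      (legal⇒independent alg s φ (pairs k)
        (legal-++ alg s φ (map unitAt (fillerStarts d r 4)) (pairs k) legal))

    -- Stated for an arbitrary `T` so that matching on `splitAt` can replace it by `X ++ Y`.
    go : ∀ T → Optimal (hard d r) T → (∀ {j} → fillers d r ↑ʳ j ∈ T → j ∈ S) →
         1 ≤ hits early false (lefts k S) d
    go T optimal T⊆S with splitAt (fillers d r) T
    ... | X , Y , refl = scanned⇒hits d r early false X Y S (optimal⇒scanned d r X Y optimal) pairFree
      (λ {j} j∈Y → T⊆S (lookup⇒[]= (fillers d r ↑ʳ j) (X ++ Y) (trans (lookup-++ʳ X Y j) ([]=⇒lookup j∈Y))))

advice-insufficient : ∀ s n k b → 2 ^ b * (2 * suc k) < 2 ^ k → 7 * k ≤ 2 * n → ¬ AdviceSuffices s n b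
advice-insufficient s n k b few long (alg , optimalOn , readsAtMost) with unhit (firstSelection alg k {b}) few
... | d , light , missed with optimal⇒hits alg s d r fit optimalOn readsAtMost
  where
  f = fillers d 0
  -- Trailing fillers extend the chain to exactly `n` intervals; `room` keeps the subtraction from
  -- truncating.
  r = n ∸ (f + k * 2)

  room : f + k * 2 ≤ n
  room = *-cancelˡ-≤ 2 (begin
    2 * (f + k * 2)   ≡⟨ solve 2 (λ f k → con 2 :* (f :+ k :* con 2) := con 2 :* f :+ con 4 :* k) refl f k ⟩
    2 * f + 4 * k     ≤⟨ +-monoˡ-≤ (4 * k) light ⟩
    3 * k + 4 * k     ≡⟨ *-distribʳ-+ k 3 4 ⟨
    7 * k             ≤⟨ long ⟩
    2 * n             ∎)
    where open ≤-Reasoning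

  fit : fillers d r + k * 2 ≡ n
  fit = begin
    fillers d r + k * 2   ≡⟨ cong (_+ k * 2) (fillers-+ d r) ⟩
    f + r + k * 2         ≡⟨ solve 3 (λ f r m → f :+ r :+ m := f :+ m :+ r) refl f r (k * 2) ⟩
    f + k * 2 + r         ≡⟨ m+[n∸m]≡n room ⟩
    n                     ∎
    where open ≡-Reasoning
... | w , hit = contradiction (missed w) (>⇒≢ hit)

-- Choice of the constants

exponential-beats-linear : ∀ q → 14 ≤ q → 64 * (2 * suc (8 * q)) < 2 ^ q
exponential-beats-linear q 14≤q = subst (λ q → 64 * (2 * suc (8 * q)) < 2 ^ q) (m+[n∸m]≡n 14≤q) (go (q ∸ 14))
  where
  go : ∀ t → 64 * (2 * suc (8 * (14 + t))) < 2 ^ (14 + t)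
  -- The base case is 14464 < 16384; at `q = 13` the inequality still fails.
  go zero    = toWitness {a? = _ <? _} _
  go (suc t) = begin-strict
    64 * (2 * suc (8 * (15 + t)))      ≤⟨ m≤m+n _ (13440 + 1024 * t) ⟩
    64 * (2 * suc (8 * (15 + t))) + (13440 + 1024 * t)
      ≡⟨ solve 1 (λ t → con 64 :* (con 2 :* (con 1 :+ con 8 :* (con 15 :+ t))) :+ (con 13440 :+ con 1024 :* t)
                     := con 2 :* (con 64 :* (con 2 :* (con 1 :+ con 8 :* (con 14 :+ t))))) refl t ⟩
    2 * (64 * (2 * suc (8 * (14 + t)))) <⟨ *-monoʳ-< 2 (go t) ⟩
    2 * 2 ^ (14 + t)                    ∎
    where open ≤-Reasoning

quarter-insufficient : ∀ s n b → 392 ≤ n → 4 * b < n → ¬ AdviceSuffices s n b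
quarter-insufficient s n b 392≤n 4b<n = advice-insufficient s n kₙ b few long
  where
  open ≤-Reasoning
  -- With `8 * q` pairs, `7 * kₙ ≤ 2 * n` amounts to `q * 28 ≤ n`, while `4 * b < n` gives
  -- `b ≤ 6 + 7 * q`. The remaining factor `2 ^ q` has to beat `64 * (2 * suc kₙ)`, which holds from
  -- `q = 14` on, that is, from `n = 392 = 14 * 28`.
  q = n ℕ./ 28
  kₙ = 8 * q

  long : 7 * kₙ ≤ 2 * n
  long = begin
    7 * (8 * q)    ≡⟨ solve 1 (λ q → con 7 :* (con 8 :* q) := con 2 :* (q :* con 28)) refl q ⟩
    2 * (q * 28)   ≤⟨ *-monoʳ-≤ 2 (m/n*n≤m n 28) ⟩
    2 * n          ∎

  b≤ : b ≤ 6 + 7 * q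
  b≤ = s≤s⁻¹ (*-cancelˡ-< 4 b (7 + 7 * q) (begin-strict
    4 * b                <⟨ 4b<n ⟩
    n                    ≡⟨ m≡m%n+[m/n]*n n 28 ⟩
    n % 28 + q * 28      <⟨ +-monoˡ-< (q * 28) (m%n<n n 28) ⟩
    28 + q * 28          ≡⟨ solve 1 (λ q → con 28 :+ q :* con 28 := con 4 :* (con 7 :+ con 7 :* q)) refl q ⟩
    4 * (7 + 7 * q)      ∎))

  few : 2 ^ b * (2 * suc kₙ) < 2 ^ kₙ
  few = begin-strict
    2 ^ b * (2 * suc kₙ)                ≤⟨ *-monoˡ-≤ (2 * suc kₙ) (^-monoʳ-≤ 2 b≤) ⟩
    2 ^ (6 + 7 * q) * (2 * suc kₙ)      ≡⟨ cong (_* (2 * suc kₙ)) (^-distribˡ-+-* 2 6 (7 * q)) ⟩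
    64 * 2 ^ (7 * q) * (2 * suc kₙ)     ≡⟨ solve 2 (λ x y → con 64 :* x :* y := x :* (con 64 :* y)) refl
                                              (2 ^ (7 * q)) (2 * suc kₙ) ⟩
    2 ^ (7 * q) * (64 * (2 * suc kₙ))   <⟨ *-monoʳ-< (2 ^ (7 * q)) {{m^n≢0 2 (7 * q)}}
                                            (exponential-beats-linear q (/-monoˡ-≤ 28 392≤n)) ⟩
    2 ^ (7 * q) * 2 ^ q                ≡⟨ ^-distribˡ-+-* 2 (7 * q) q ⟨
    2 ^ (7 * q + q)                    ≡⟨ cong (2 ^_) (+-comm (7 * q) q) ⟩
    2 ^ kₙ                              ∎

n/4≤b : ∀ n b → n ≤ 4 * b → ℤ.+ n ℚ./ 4 ℚ.≤ ℤ.+ b ℚ./ 1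
n/4≤b n b n≤4b = ℚ.toℚᵘ-cancel-≤ (begin
  ℚ.toℚᵘ (ℤ.+ n ℚ./ 4)   ≃⟨ ℚ.toℚᵘ-fromℚᵘ (ℚᵘ.mkℚᵘ (ℤ.+ n) 3) ⟩
  -- `mkℚᵘ` stores the denominator minus one, so 3 stands for 4 and 0 for 1; the inequality is
  -- checked by cross-multiplication.
  ℚᵘ.mkℚᵘ (ℤ.+ n) 3      ≤⟨ ℚᵘ.*≤* (subst₂ ℤ._≤_ (sym (ℤ.*-identityʳ (ℤ.+ n))) (ℤ.pos-* b 4)
                                (ℤ.+≤+ (≤-trans n≤4b (≤-reflexive (*-comm 4 b))))) ⟩
  ℚᵘ.mkℚᵘ (ℤ.+ b) 0      ≃⟨ ℚ.toℚᵘ-fromℚᵘ (ℚᵘ.mkℚᵘ (ℤ.+ b) 0) ⟨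
  ℚ.toℚᵘ (ℤ.+ b ℚ./ 1)   ∎)
  where open ℚᵘ.≤-Reasoning

open import Data.Integer using (+_)
open import Data.Rational using (_/_)

theorem11 : ∃[ n₀ ] (∀ (n : ℕ) → n₀ ≤ n → ∀ (s : Setting) → AdviceComplexity≥ s n (+ n / 4))
theorem11 = 392 , bound
  where
  bound : ∀ n → 392 ≤ n → ∀ s → AdviceComplexity≥ s n (+ n / 4)
  bound n 392≤n s b suffices with n ≤? 4 * b
  ... | yes n≤4b = n/4≤b n b n≤4b
  ... | no  n≰4b = contradiction suffices (quarter-insufficient s n b 392≤n (≰⇒> n≰4b))
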